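{- The following three rules are admissible in $\mathcal{C}_{\mathsf{IM}}$ (where $|\Lambda|\leq 1$ in $\mathsf{sub}^\bullet$ and $|\Delta|\leq 1$ in $\mathsf{sub}^\circ$): - $\mathsf{cut}$: from $\Lambda,\varphi^\circ$ and $\varphi^\bullet,\Delta$ infer $\Lambda,\Delta$; - $\mathsf{sub}^\bullet$: from $\Lambda,\varphi^\circ$ and $\{\varphi^\bullet\},\Delta$ infer $\{\Lambda\},\Delta$; - $\mathsf{sub}^\circ$: from $\Lambda,\{\varphi^\circ\}$ and $\varphi^\bullet,\Delta$ infer $\Lambda,\{\Delta\}$.
   Context: Language: $\mathcal{L}$ is generated by $\varphi ::= p \mid \bot \mid \varphi\wedge\varphi \mid \varphi\vee\varphi \mid \varphi\to\varphi \mid \Box\varphi \mid \Diamond\varphi$. Sequents: a marked formula is an input formula $\varphi^\bullet$ or an output formula $\varphi^\circ$ with $\varphi\in\mathcal{L}$. A block is $\{\Delta\}$ where $\Delta$ contains at most one marked formula; it is an input block if $\Delta=\varphi^\bullet$ or $\Delta$ is empty, and an output block if $\Delta=\varphi^\circ$. A sequent has the form $\Gamma=\Lambda,\Pi$ where $\Lambda$ is a finite multiset of input formulas and input blocks and $\Pi$ is empty, or one output formula $\varphi^\circ$, or one output block $\{\varphi^\circ\}$. $\Gamma,\Delta$ range over sequents, $\Lambda$ over sequents with only input components; whatever is placed inside a block consists of at most one marked formula; $|\Delta|$ is the number of formulas in $\Delta$; all rule instances must consist of sequents. The output pruning $\Gamma^\downarrow$ is $\Gamma$ with its output formula (if any)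 removed; if the output formula is inside a block, the block is kept but emptied to $\{\ \}$. Rules of $\mathcal{C}_{\mathsf{IM}}$ (premisses / conclusion): $\bot^\bullet$: (no premiss) / $\Gamma,\bot^\bullet$. $\mathsf{id}$: (no premiss) / $\Lambda,p^\bullet,p^\circ$ ($p$ a proposition letter). $\wedge^\bullet$: $\Gamma,\varphi^\bullet,\psi^\bullet$ / $\Gamma,(\varphi\wedge\psi)^\bullet$. $\wedge^\circ$: $\Lambda,\varphi^\circ$ and $\Lambda,\psi^\circ$ / $\Lambda,(\varphi\wedge\psi)^\circ$. $\vee^\bullet$: $\Gamma,\varphi^\bullet$ and $\Gamma,\psi^\bullet$ / $\Gamma,(\varphi\vee\psi)^\bullet$. $\vee^\circ$: $\Lambda,\varphi^\circ$ / $\Lambda,(\varphi\vee\psi)^\circ$; and $\Lambda,\psi^\circ$ / $\Lambda,(\varphi\vee\psi)^\circ$. $\to^\bullet$: $\Gamma^\downarrow,(\varphi\to\psi)^\bullet,\varphi^\circ$ and $\Gamma,\psi^\bullet$ / $\Gamma,(\varphi\to\psi)^\bullet$. $\to^\circ$: $\Lambda,\varphi^\bullet,\psi^\circ$ / $\Lambda,(\varphi\to\psi)^\circ$. $\Box^\bullet$: $\Gamma,\{\varphi^\bullet\}$ / $\Gamma,(\Box\varphi)^\bullet$. $\Box^\circ$ ($|\Delta|\leq 1$): $\Delta,\varphi^\circ$ / $\Lambda,\{\Delta\},(\Box\varphi)^\circ$. $\Diamond^\bullet$ ($|\Delta|\leq 1$): $\varphi^\bullet,\Delta$ / $\Gamma,(\Diamond\varphi)^\bullet,\{\Delta\}$.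 $\Diamond^\circ$: $\Lambda,\{\varphi^\circ\}$ / $\Lambda,(\Diamond\varphi)^\circ$. A rule is admissible in a calculus if derivability of its premisses implies derivability of its conclusion. -}

module Defs where

open import Data.List.Base using (List; []; _∷_; _++_)
open import Data.List.Relation.Binary.Permutation.Propositional using (_↭_)
open import Data.Maybe.Base using (Maybe; just; nothing)
open import Data.Nat.Base using (ℕ)

infix  10 _• _°
infix  9  □_ ◇_
infixr 8  _∧_
infixr 7  _∨_
infixr 6  _⇒_
infix  4  _⨟_
infixr 4  _⊕_
infix  3  ⊢_

data Fm : Set where
  var         : ℕ → Fm
  ⊥           : Fm
  _∧_ _∨_ _⇒_ : Fm → Fm → Fm
  □_ ◇_       : Fm → Fm

data Side : Set where
  inp out : Side

data Marked : Side → Set where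
  _• : Fm → Marked inp
  _° : Fm → Marked out

-- What may stand inside a block: at most one marked formula.  This is the
-- range of every Δ subject to |Δ| ≤ 1 that occurs in a block ｛ Δ ｝, since
-- blocks do not nest.  The empty content counts as input.
data Content : Side → Set where
  ∅   : Content inp
  one : ∀ {s} → Marked s → Content s

data Component : Side → Set where
  fm   : ∀ {s} → Marked s → Component s
  ｛_｝ : ∀ {s} → Content s → Component s

-- Input-only sequents Λ.  Multisets are lists up to the rule exch below.
Inputs : Set
Inputs = List (Component inp)

record Sequent : Set where
  constructor _⨟_
  field
    inputs : Inputs
    output : Maybe (Component out)

open Sequent public

_⊕_ : Inputs → Sequent → Sequent
Λ ⊕ (Λ′ ⨟ Π) = Λ ++ Λ′ ⨟ Π

single : ∀ {s} → Component s → Sequent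
single {inp} c = c ∷ [] ⨟ nothing
single {out} c = [] ⨟ just c

-- The content of a block, read as a sequent in its own right.
contents : ∀ {s} → Content s → Sequent
contents ∅       = [] ⨟ nothing
contents (one m) = single (fm m)

-- Output pruning; its result never has an output, hence the codomain.
_↓ : Sequent → Inputs
(Λ ⨟ nothing) ↓          = Λ
(Λ ⨟ just (fm _)) ↓      = Λ
(Λ ⨟ just ｛ one _ ｝) ↓ = ｛ ∅ ｝ ∷ Λ

-- An arbitrary context Γ is written Λ ⨟ Π.  Apart from exch, the constructors
-- are the rules of C_IM.
data ⊢_ : Sequent → Set where
  exch : ∀ {Λ Λ′ Π} → Λ ↭ Λ′ → ⊢ Λ ⨟ Π → ⊢ Λ′ ⨟ Π

  ⊥•  : ∀ {Λ Π} → ⊢ fm (⊥ •) ∷ Λ ⨟ Π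

  ax  : ∀ {Λ p} → ⊢ fm (var p •) ∷ Λ ⨟ just (fm (var p °))

  ∧•  : ∀ {Λ Π φ ψ} →
        ⊢ fm (φ •) ∷ fm (ψ •) ∷ Λ ⨟ Π →
        ⊢ fm ((φ ∧ ψ) •) ∷ Λ ⨟ Π

  ∧°  : ∀ {Λ φ ψ} →
        ⊢ Λ ⨟ just (fm (φ °)) →
        ⊢ Λ ⨟ just (fm (ψ °)) →
        ⊢ Λ ⨟ just (fm ((φ ∧ ψ) °))

  ∨•  : ∀ {Λ Π φ ψ} →
        ⊢ fm (φ •) ∷ Λ ⨟ Π →
        ⊢ fm (ψ •) ∷ Λ ⨟ Π →
        ⊢ fm ((φ ∨ ψ) •) ∷ Λ ⨟ Π

  ∨°₁ : ∀ {Λ φ ψ} →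
        ⊢ Λ ⨟ just (fm (φ °)) →
        ⊢ Λ ⨟ just (fm ((φ ∨ ψ) °))

  ∨°₂ : ∀ {Λ φ ψ} →
        ⊢ Λ ⨟ just (fm (ψ °)) →
        ⊢ Λ ⨟ just (fm ((φ ∨ ψ) °))

  ⇒•  : ∀ {Λ Π φ ψ} →
        ⊢ fm ((φ ⇒ ψ) •) ∷ (Λ ⨟ Π) ↓ ⨟ just (fm (φ °)) →
        ⊢ fm (ψ •) ∷ Λ ⨟ Π →
        ⊢ fm ((φ ⇒ ψ) •) ∷ Λ ⨟ Π

  ⇒°  : ∀ {Λ φ ψ} →
        ⊢ fm (φ •) ∷ Λ ⨟ just (fm (ψ °)) →
        ⊢ Λ ⨟ just (fm ((φ ⇒ ψ) °))

  □•  : ∀ {Λ Π φ} →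
        ⊢ ｛ one (φ •) ｝ ∷ Λ ⨟ Π →
        ⊢ fm ((□ φ) •) ∷ Λ ⨟ Π

  -- Δ cannot be an output: the conclusion already has one.
  □°  : ∀ {Λ φ} (Δ : Content inp) →
        ⊢ inputs (contents Δ) ⨟ just (fm (φ °)) →
        ⊢ ｛ Δ ｝ ∷ Λ ⨟ just (fm ((□ φ) °))

  -- The rule  φ• , Δ / Γ , (◇φ)• , ｛ Δ ｝, split by the side of Δ: if Δ is
  -- an output formula, then Γ must be input-only for the conclusion to be a
  -- sequent.
  ◇•ᵢ : ∀ {Λ Π φ} (Δ : Content inp) →
        ⊢ fm (φ •) ∷ [] ⊕ contents Δ →
        ⊢ fm ((◇ φ) •) ∷ ｛ Δ ｝ ∷ Λ ⨟ Π

  ◇•ₒ : ∀ {Λ φ} (Δ : Content out) →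
        ⊢ fm (φ •) ∷ [] ⊕ contents Δ →
        ⊢ fm ((◇ φ) •) ∷ Λ ⨟ just ｛ Δ ｝

  ◇°  : ∀ {Λ φ} →
        ⊢ Λ ⨟ just ｛ one (φ °) ｝ →
        ⊢ Λ ⨟ just (fm ((◇ φ) °))

{-# OPTIONS --safe #-}
module Submission where

-- Cut elimination in additive form: from Λ , φ° and φ• , Λ , Π infer Λ , Π, by
-- induction on φ and the left derivation, simultaneously with sub°.
-- Weakening, contraction, exchange and the invertibility of the left rules are
-- obtained by one induction: Γ′ simulates Γ when every input of Γ is covered by
-- Γ′, a component being covered if it occurs, or if what an invertible left
-- rule makes of it is covered.  The left rules for ⇒ and ◇ and the rules that
-- use up a block are not invertible; a cut formula of these kinds is instead
-- covered by a function that eliminates it (Elim), so that the induction on the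
-- right derivation is the same one again.

open import Data.Empty using () renaming (⊥ to Empty)
open import Data.List.Base using ([]; _∷_; _++_)
open import Data.List.Membership.Propositional using (_∈_)
open import Data.List.Membership.Propositional.Properties using (∈-∃++; ∈-++⁺ˡ; ∈-++⁺ʳ)
open import Data.List.Relation.Binary.Permutation.Propositional
  using (_↭_; ↭-refl; ↭-sym; ↭-trans; prep; swap)
open import Data.List.Relation.Binary.Permutation.Propositional.Properties
  using (All-resp-↭; ∈-resp-↭; shift; ++⁺ʳ)
open import Data.List.Relation.Unary.All as All using (All; []; _∷_)
open import Data.List.Relation.Unary.All.Properties using () renaming (++⁺ to All-++⁺)
open import Data.List.Relation.Unary.Any using (here; there)
open import Data.Maybe.Base using (Maybe; just; nothing)
open import Data.Product.Base using (_×_; _,_; ∃-syntax; -,_)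
open import Relation.Binary.PropositionalEquality using (refl)
open import Defs

private variable
  s       : Side
  c       : Component inp
  φ ψ     : Fm
  Λ Λ′    : Inputs
  Π Π′    : Maybe (Component out)
  Γ Γ′ Γ″ : Sequent

-- Coverings and eliminations

infix 3 _∋_ _∋ᵇ_ _≼_ _⊑_ _≤ᵒ_

-- An output block also counts as the input ｛ ∅ ｝, the form in which the left
-- premise of ⇒• keeps it.
data _∋_ : Sequent → Component inp → Set where
  inside : c ∈ Λ → Λ ⨟ Π ∋ c
  pruned : {Δ : Content out} → Λ ⨟ just ｛ Δ ｝ ∋ ｛ ∅ ｝

-- Lets `◇•ᵢ` and `◇•ₒ` be treated as one rule.
data _∋ᵇ_ : Sequent → Content s → Set where
  inside  : {Δ : Content inp} → ｛ Δ ｝ ∈ Λ → Λ ⨟ Π ∋ᵇ Δ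
  outside : {Δ : Content out} → Λ ⨟ just ｛ Δ ｝ ∋ᵇ Δ

-- `blk` is weakening inside a block. Several inputs may share one cover, which accounts for
-- contraction.
data Cover (E : Sequent → Component inp → Set) (Γ : Sequent) : Component inp → Set where
  mem  : Γ ∋ c → Cover E Γ c
  blk  : {Δ : Content inp} → Γ ∋ ｛ Δ ｝ → Cover E Γ ｛ ∅ ｝
  and  : Cover E Γ (fm (φ •)) → Cover E Γ (fm (ψ •)) → Cover E Γ (fm ((φ ∧ ψ) •))
  orˡ  : Cover E Γ (fm (φ •)) → Cover E Γ (fm ((φ ∨ ψ) •))
  orʳ  : Cover E Γ (fm (ψ •)) → Cover E Γ (fm ((φ ∨ ψ) •))
  imp  : Cover E Γ (fm (ψ •)) → Cover E Γ (fm ((φ ⇒ ψ) •))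
  box  : Cover E Γ ｛ one (φ •) ｝ → Cover E Γ (fm ((□ φ) •))
  elim : E Γ c → Cover E Γ c

Cover₀ : Sequent → Component inp → Set
Cover₀ = Cover (λ _ _ → Empty)

_⊑_ : Sequent → Sequent → Set
Γ ⊑ Γ′ = ∀ {c} → Γ ∋ c → Cover₀ Γ′ c

-- Quantifying over all `Γ′` above `Γ` keeps the first two functions usable while the target sequent
-- changes. `elim｛｝` asks only for the contents of `Δ`, since a rule that enters a block discards
-- everything outside it.
data Elim (Γ : Sequent) : Component inp → Set where
  elim⇒ : (∀ {Γ′} → Γ ⊑ Γ′ → ⊢ Γ′ ↓ ⨟ just (fm (φ °)) →
           ⊢ (fm (ψ •) ∷ []) ⊕ Γ′ → ⊢ Γ′) →
          Elim Γ (fm ((φ ⇒ ψ) •))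
  elim◇ : (∀ {Γ′ s} {Δ : Content s} → Γ ⊑ Γ′ → Γ′ ∋ᵇ Δ →
           ⊢ (fm (φ •) ∷ []) ⊕ contents Δ → ⊢ Γ′) →
          Elim Γ (fm ((◇ φ) •))
  elim｛｝ : {Δ : Content inp} → Γ ∋ ｛ Δ ｝ →
          (∀ {Γ′} → All (Cover₀ Γ′) (inputs (contents Δ)) →
           ⊢ (fm (φ •) ∷ []) ⊕ Γ′ → ⊢ Γ′) →
          Elim Γ ｛ one (φ •) ｝

Cover₁ : Sequent → Component inp → Set
Cover₁ = Cover Elim

_≼_ : Inputs → Sequent → Set
Λ ≼ Γ = All (Cover₁ Γ) Λ

data _≤ᵒ_ : Maybe (Component out) → Maybe (Component out) → Set where
  none : nothing ≤ᵒ Π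
  same : Π ≤ᵒ Π

-- Monotonicity of coverings

cover-weaken : ∀ {E} → Cover₀ Γ c → Cover E Γ c
cover-weaken (mem h)   = mem h
cover-weaken (blk h)   = blk h
cover-weaken (and a b) = and (cover-weaken a) (cover-weaken b)
cover-weaken (orˡ a)   = orˡ (cover-weaken a)
cover-weaken (orʳ a)   = orʳ (cover-weaken a)
cover-weaken (imp a)   = imp (cover-weaken a)
cover-weaken (box a)   = box (cover-weaken a)

cover-mono : ∀ {E} → Γ ⊑ Γ′ → (∀ {c} → E Γ c → Cover E Γ′ c) →
             Cover E Γ c → Cover E Γ′ c
cover-mono s e (mem h) = cover-weaken (s h)
cover-mono s e (blk h) with s h
... | mem h′ = blk h′
... | blk h′ = blk h′
cover-mono s e (and a b) = and (cover-mono s e a) (cover-mono s e b)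
cover-mono s e (orˡ a)   = orˡ (cover-mono s e a)
cover-mono s e (orʳ a)   = orʳ (cover-mono s e a)
cover-mono s e (imp a)   = imp (cover-mono s e a)
cover-mono s e (box a)   = box (cover-mono s e a)
cover-mono s e (elim x)  = e x

cover₀-mono : Γ ⊑ Γ′ → Cover₀ Γ c → Cover₀ Γ′ c
cover₀-mono s = cover-mono s λ ()

⊑-trans : Γ ⊑ Γ′ → Γ′ ⊑ Γ″ → Γ ⊑ Γ″
⊑-trans s t h = cover₀-mono t (s h)

elim-mono : Γ ⊑ Γ′ → Elim Γ c → Cover₁ Γ′ c
elim-mono s (elim⇒ k) = elim (elim⇒ λ t → k (⊑-trans s t))
elim-mono s (elim◇ k) = elim (elim◇ λ t → k (⊑-trans s t))
elim-mono s (elim｛｝ h k) with s h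
... | mem h′ = elim (elim｛｝ h′ k)
-- `blk` forces the old block to be `∅`, so `k` asks nothing of the contents of the new one.
... | blk h′ = elim (elim｛｝ h′ λ _ → k [])

≼-mono : Γ ⊑ Γ′ → Λ ≼ Γ → Λ ≼ Γ′
≼-mono s = All.map (cover-mono s (elim-mono s))

⊑-cons : Λ ⨟ Π ⊑ c ∷ Λ ⨟ Π
⊑-cons (inside i) = mem (inside (there i))
⊑-cons pruned     = mem pruned

-- When a left rule replaces its principal formula `c` by `Ξ`, other inputs may rely on the same
-- `c`; they stay covered because the premise still covers `c`.
⊑-replace : ∀ Ξ → c ∷ Λ ↭ Λ′ → Cover₀ (Ξ ++ Λ ⨟ Π) c → Λ′ ⨟ Π ⊑ Ξ ++ Λ ⨟ Π
⊑-replace Ξ p x (inside i) with ∈-resp-↭ (↭-sym p) i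
... | here refl = x
... | there j   = mem (inside (∈-++⁺ʳ Ξ j))
⊑-replace Ξ p x pruned = mem pruned

⊑-output : Λ ⨟ just (fm (φ °)) ⊑ Λ ⨟ Π
⊑-output (inside i) = mem (inside i)

⊑-prune : Γ ⊑ Γ ↓ ⨟ Π
⊑-prune {_ ⨟ nothing}            (inside i) = mem (inside i)
⊑-prune {_ ⨟ just (fm (_ °))}    (inside i) = mem (inside i)
⊑-prune {_ ⨟ just ｛ one (_ °) ｝} (inside i) = mem (inside (there i))
⊑-prune {_ ⨟ just ｛ one (_ °) ｝} pruned     = mem (inside (here refl))

cover-prune : All (Cover₀ Γ) (Γ ↓)
cover-prune {_ ⨟ nothing}            = All.tabulate λ i → mem (inside i)
cover-prune {_ ⨟ just (fm (_ °))}    = All.tabulate λ i → mem (inside i)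
cover-prune {_ ⨟ just ｛ one (_ °) ｝} = mem pruned ∷ All.tabulate λ i → mem (inside i)

≼-prune : Π ≤ᵒ Π′ → Λ ≼ (Λ′ ⨟ Π′) → (Λ ⨟ Π) ↓ ≼ (Λ′ ⨟ Π′)
≼-prune none cs = cs
≼-prune {nothing} same cs = cs
≼-prune {just (fm (_ °))} same cs = cs
≼-prune {just ｛ one (_ °) ｝} same cs = mem pruned ∷ cs

↓-cong : ∀ Π → Λ ↭ Λ′ → (Λ ⨟ Π) ↓ ↭ (Λ′ ⨟ Π) ↓
↓-cong nothing              p = p
↓-cong (just (fm (_ °)))    p = p
↓-cong (just ｛ one (_ °) ｝) p = prep _ p

↓-cons : ∀ Π → (c ∷ Λ ⨟ Π) ↓ ↭ c ∷ (Λ ⨟ Π) ↓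
↓-cons nothing              = ↭-refl
↓-cons (just (fm (_ °)))    = ↭-refl
↓-cons (just ｛ one (_ °) ｝) = swap _ _ ↭-refl

∈⇒↭ : c ∈ Λ → ∃[ Λ′ ] (c ∷ Λ′ ↭ Λ)
∈⇒↭ i with ys , zs , refl ← ∈-∃++ i = ys ++ zs , ↭-sym (shift _ ys zs)

◇•-∈ : {Δ : Content s} → fm ((◇ φ) •) ∈ Λ → Λ ⨟ Π ∋ᵇ Δ →
      ⊢ (fm (φ •) ∷ []) ⊕ contents Δ → ⊢ Λ ⨟ Π
◇•-∈ i outside d with _ , p ← ∈⇒↭ i = exch p (◇•ₒ _ d)
◇•-∈ i (inside j) d with _ , p ← ∈⇒↭ i with ∈-resp-↭ (↭-sym p) j
... | there j′ with _ , q ← ∈⇒↭ j′ = exch (↭-trans (prep _ q) p) (◇•ᵢ _ d)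

mem₀ : ∀ {E} → Cover E (c ∷ Λ ⨟ Π) c
mem₀ = mem (inside (here refl))

mem₁ : ∀ {E b} → Cover E (b ∷ c ∷ Λ ⨟ Π) c
mem₁ = mem (inside (there (here refl)))

mem₂ : ∀ {E a b} → Cover E (a ∷ b ∷ c ∷ Λ ⨟ Π) c
mem₂ = mem (inside (there (there (here refl))))

-- Induction on the derivation: for a principal formula, `mem` repeats the rule, an inversion
-- constructor passes straight to a premise, and `elim` hands the premises to the eliminating
-- function.
simulate : ⊢ Γ → output Γ ≤ᵒ output Γ′ → inputs Γ ≼ Γ′ → ⊢ Γ′

-- The block ∅ can be covered by the pruned output block, so the content that
-- takes its place may be an output.
refill : {Δ : Content inp} → ⊢ (fm (φ •) ∷ []) ⊕ contents Δ → Cover₁ Γ ｛ Δ ｝ →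
         ∃[ s ] ∃[ Δ′ ] (Γ ∋ᵇ Δ′ × ⊢ (fm (φ •) ∷ []) ⊕ contents {s} Δ′)

simulate (exch p d) o cs = simulate d o (All-resp-↭ (↭-sym p) cs)
simulate ⊥• o (mem (inside i) ∷ cs) with _ , p ← ∈⇒↭ i = exch p ⊥•
simulate ax same (mem (inside i) ∷ cs) with _ , p ← ∈⇒↭ i = exch p ax
simulate (∧• d) o (and a b ∷ cs) = simulate d o (a ∷ b ∷ cs)
simulate (∧• d) o (mem (inside i) ∷ cs) with _ , p ← ∈⇒↭ i =
  exch p (∧• (simulate d o (mem₀ ∷ mem₁ ∷
    ≼-mono (⊑-replace (_ ∷ _ ∷ []) p (and mem₀ mem₁)) cs)))
simulate (∧° d e) same cs =
  ∧° (simulate d same (≼-mono ⊑-output cs)) (simulate e same (≼-mono ⊑-output cs))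
simulate (∨• d e) o (orˡ a ∷ cs) = simulate d o (a ∷ cs)
simulate (∨• d e) o (orʳ a ∷ cs) = simulate e o (a ∷ cs)
simulate (∨• d e) o (mem (inside i) ∷ cs) with _ , p ← ∈⇒↭ i =
  exch p (∨• (simulate d o (mem₀ ∷ ≼-mono (⊑-replace (_ ∷ []) p (orˡ mem₀)) cs))
             (simulate e o (mem₀ ∷ ≼-mono (⊑-replace (_ ∷ []) p (orʳ mem₀)) cs)))
simulate (∨°₁ d) same cs = ∨°₁ (simulate d same (≼-mono ⊑-output cs))
simulate (∨°₂ d) same cs = ∨°₂ (simulate d same (≼-mono ⊑-output cs))
simulate (⇒• d e) o (imp a ∷ cs) = simulate e o (a ∷ cs)
simulate {Γ′ = _ ⨟ Π} (⇒• d e) o (mem (inside i) ∷ cs) with _ , p ← ∈⇒↭ i =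
  exch p (⇒• (exch (↭-trans (↓-cong Π (↭-sym p)) (↓-cons Π))
               (simulate d same (≼-mono ⊑-prune (mem (inside i) ∷ ≼-prune o cs))))
             (simulate e o (mem₀ ∷ ≼-mono (⊑-replace (_ ∷ []) p (imp mem₀)) cs)))
simulate (⇒• d e) o (elim (elim⇒ k) ∷ cs) =
  -- The left premise repeats the implication, so it must be eliminated there too.
  k mem (simulate d same (≼-mono ⊑-prune (elim (elim⇒ k) ∷ ≼-prune o cs)))
        (simulate e o (mem₀ ∷ ≼-mono ⊑-cons cs))
simulate (⇒° d) same cs =
  ⇒° (simulate d same (mem₀ ∷ ≼-mono (⊑-trans ⊑-output ⊑-cons) cs))
simulate (□• d) o (box a ∷ cs) = simulate d o (a ∷ cs)
simulate (□• d) o (mem (inside i) ∷ cs) with _ , p ← ∈⇒↭ i =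
  exch p (□• (simulate d o (mem₀ ∷ ≼-mono (⊑-replace (_ ∷ []) p (box mem₀)) cs)))
simulate (□° Δ d) same (mem (inside i) ∷ cs) with _ , p ← ∈⇒↭ i = exch p (□° Δ d)
simulate (□° ∅ d) same (blk (inside i) ∷ cs) with _ , p ← ∈⇒↭ i =
  exch p (□° _ (simulate d same []))
simulate (□° _ d) same (elim (elim｛｝ (inside i) k) ∷ cs) with _ , p ← ∈⇒↭ i =
  exch p (□° _ (k (All.tabulate λ j → mem (inside j)) (simulate d same (mem₀ ∷ []))))
simulate (◇•ᵢ Δ d) o (a ∷ b ∷ cs) with _ , _ , j , d′ ← refill d b | a
... | mem (inside i)  = ◇•-∈ i j d′
... | elim (elim◇ k) = k mem j d′
simulate (◇•ₒ Δ d) same (mem (inside i) ∷ cs)  = ◇•-∈ i outside d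
simulate (◇•ₒ Δ d) same (elim (elim◇ k) ∷ cs) = k mem outside d
simulate (◇° d) same cs = ◇° (simulate d same (≼-mono ⊑-output cs))

refill d (mem (inside i)) = -, -, inside i , d
refill d (mem pruned) = -, -, outside , simulate d none (mem₀ ∷ [])
refill d (blk (inside i)) = -, -, inside i , simulate d none (mem₀ ∷ [])
refill d (blk pruned) = -, -, outside , simulate d none (mem₀ ∷ [])
-- `k` cuts the first formula, so the formula of the block is exchanged with that of the ◇.
refill d (elim (elim｛｝ (inside i) k)) =
  -, -, inside i ,
  k (All.tabulate λ j → mem (inside (there j))) (simulate d none (mem₁ ∷ mem₀ ∷ []))
refill d (elim (elim｛｝ pruned k)) =
  -, -, outside , k [] (simulate d none (mem₁ ∷ mem₀ ∷ []))

-- Structural rules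

structural : ⊢ Γ → output Γ ≤ᵒ output Γ′ → All (Cover₀ Γ′) (inputs Γ) → ⊢ Γ′
structural d o cs = simulate d o (All.map cover-weaken cs)

inputs-⊑ : ∀ Γ → Γ ⊑ Γ′ → All (Cover₀ Γ′) (inputs Γ)
inputs-⊑ _ s = All.tabulate λ i → s (inside i)

inputs-++ : ∀ Ξ → All (Cover₀ (Ξ ++ Λ ⨟ Π)) Λ
inputs-++ Ξ = All.tabulate λ i → mem (inside (∈-++⁺ʳ Ξ i))

⊑-prune-cons : Γ ⊑ c ∷ Γ ↓ ⨟ Π
⊑-prune-cons {Π = Π} = ⊑-trans ⊑-prune (⊑-cons {Π = Π})

⊕-single : (Δ : Content s) → Λ ⊕ single ｛ Δ ｝ ∋ᵇ Δ
⊕-single {inp} Δ = inside (∈-++⁺ʳ _ (here refl))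
⊕-single {out} Δ = outside

∋ᵇ⇒cover : {Δ : Content s} → Γ ∋ᵇ Δ → Cover₀ Γ ｛ ∅ ｝
∋ᵇ⇒cover (inside i) = blk (inside i)
∋ᵇ⇒cover outside    = mem pruned

-- Contracts the copy of the block that `sub°` produces with the one already in `Γ`.
absorb : {Δ : Content s} → Γ ∋ᵇ Δ → ⊢ Γ ↓ ⊕ single ｛ Δ ｝ → ⊢ Γ
absorb (inside i) d = structural d none (All-++⁺ cover-prune (mem (inside i) ∷ []))
absorb outside    d = structural d same (All-++⁺ cover-prune [])

-- Cut and substitution into a block

cut : ∀ φ → ⊢ Λ ⨟ just (fm (φ °)) → ⊢ fm (φ •) ∷ Λ ⨟ Π → ⊢ Λ ⨟ Π

-- Cuts over the shared context `Γ ↓`, where an output block of `Γ` is available as the input `∅`;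
-- that surplus block is contracted away at the end.
cut-mix : ∀ φ → All (Cover₀ Γ) Λ → ⊢ Λ ⨟ just (fm (φ °)) → ⊢ (fm (φ •) ∷ []) ⊕ Γ → ⊢ Γ

sub° : ∀ φ (Δ : Content s) → ⊢ Λ ⨟ just ｛ one (φ °) ｝ →
       ⊢ (fm (φ •) ∷ []) ⊕ contents Δ → ⊢ Λ ⊕ single ｛ Δ ｝

cut-mix {Γ = Γ} φ s d e =
  structural
    (cut φ (structural {Γ′ = Γ ↓ ⨟ _} d same (All.map (cover₀-mono ⊑-prune) s))
           (structural e same (mem₀ ∷ inputs-⊑ Γ ⊑-prune-cons)))
    same cover-prune

cut φ (exch p d) e = exch p (cut φ d (exch (prep _ (↭-sym p)) e))
cut φ ⊥• e = ⊥•
cut _ ax e = structural e same (mem₀ ∷ inputs-++ [])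
-- The left rule moves below the cut; the right derivation follows by inverting the same formula in
-- its context.
cut φ (∧• d) e =
  ∧• (cut φ d (structural e same (mem₀ ∷ and mem₁ mem₂ ∷ inputs-++ (_ ∷ _ ∷ _ ∷ []))))
cut (φ ∧ ψ) (∧° d e) f =
  cut φ d (cut ψ (structural e same (inputs-++ (_ ∷ [])))
    (structural f same (and mem₁ mem₀ ∷ inputs-++ (_ ∷ _ ∷ []))))
cut φ (∨• d e) f =
  ∨• (cut φ d (structural f same (mem₀ ∷ orˡ mem₁ ∷ inputs-++ (_ ∷ _ ∷ []))))
     (cut φ e (structural f same (mem₀ ∷ orʳ mem₁ ∷ inputs-++ (_ ∷ _ ∷ []))))
cut (φ ∨ ψ) (∨°₁ d) e =
  cut φ d (structural e same (orˡ mem₀ ∷ inputs-++ (_ ∷ [])))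
cut (φ ∨ ψ) (∨°₂ d) e =
  cut ψ d (structural e same (orʳ mem₀ ∷ inputs-++ (_ ∷ [])))
cut {Π = Π} φ (⇒• d e) f =
  ⇒• (structural d same (mem₀ ∷ inputs-⊑ (_ ⨟ Π) ⊑-prune-cons))
     (cut φ e (structural f same (mem₀ ∷ imp mem₁ ∷ inputs-++ (_ ∷ _ ∷ []))))
cut (φ ⇒ ψ) (⇒° d) e =
  simulate e same (elim (elim⇒ eliminate) ∷ All.map cover-weaken (inputs-++ []))
  where
  eliminate : _ ⊑ Γ → ⊢ Γ ↓ ⨟ just (fm (φ °)) → ⊢ (fm (ψ •) ∷ []) ⊕ Γ → ⊢ Γ
  eliminate s a b =
    -- Principal reduction: `φ` is cut into the premise of `⇒°`, then `ψ` into `b`.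
    cut-mix ψ cover-prune
      (cut φ a (structural d same (mem₀ ∷ inputs-⊑ _ (⊑-trans s ⊑-prune-cons))))
      b
cut φ (□• d) e =
  □• (cut φ d (structural e same (mem₀ ∷ box mem₁ ∷ inputs-++ (_ ∷ _ ∷ []))))
cut (□ φ) (□° Δ d) e =
  -- Inverting `□ φ` gives a block `φ•`. The block `Δ` takes its place, since `d` derives `φ` from
  -- its contents.
  simulate e same
    (box (elim (elim｛｝ (inside (here refl)) λ cs → cut-mix φ cs d)) ∷
     All.map cover-weaken (inputs-++ []))
cut φ (◇•ᵢ Δ d) e = ◇•ᵢ Δ d
cut (◇ φ) (◇° d) e =
  simulate e same (elim (elim◇ eliminate) ∷ All.map cover-weaken (inputs-++ []))
  where
  eliminate : {Δ : Content s} → _ ⊑ Γ → Γ ∋ᵇ Δ → ⊢ (fm (φ •) ∷ []) ⊕ contents Δ → ⊢ Γ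
  eliminate {Δ = Δ} s j a =
    absorb j (sub° φ Δ (structural d same (inputs-⊑ _ (⊑-trans s ⊑-prune))) a)

sub° φ Δ (exch p d) e = exch (++⁺ʳ _ p) (sub° φ Δ d e)
sub° φ Δ ⊥• e = ⊥•
sub° φ Δ (∧• d) e = ∧• (sub° φ Δ d e)
sub° φ Δ (∨• d d′) e = ∨• (sub° φ Δ d e) (sub° φ Δ d′ e)
sub° φ Δ (⇒• {Λ} d d′) e =
  -- The left premise keeps the pruned block as `∅`, which is covered by what pruning leaves of the
  -- block `Δ`.
  ⇒• (structural d same
       (mem₀ ∷ cover₀-mono ⊑-prune-cons (∋ᵇ⇒cover (⊕-single Δ)) ∷
        All.tabulate λ i → ⊑-prune-cons {Γ = Λ ⊕ single ｛ Δ ｝} (inside (∈-++⁺ˡ i))))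
     (sub° φ Δ d′ e)
sub° φ Δ (□• d) e = □• (sub° φ Δ d e)
sub° φ Δ (◇•ᵢ Δ′ d) e = ◇•ᵢ Δ′ d
sub° φ Δ (◇•ₒ _ d) e =
  -- Only here is the output block used up: `φ` is cut inside the block, and the ◇ rule is reapplied
  -- to `Δ`.
  ◇•-∈ (here refl) (⊕-single Δ)
    (cut-mix φ (mem₀ ∷ []) d (structural e same (mem₀ ∷ inputs-++ (_ ∷ _ ∷ []))))

theorem3p12 :
    (∀ (Λ : Inputs) (Δ : Sequent) (φ : Fm) →
       ⊢ (Λ ⨟ just (fm (φ °))) →
       ⊢ ((fm (φ •) ∷ []) ⊕ Δ) →
       ⊢ (Λ ⊕ Δ))
    ×
    (∀ (Λ : Content inp) (Δ : Sequent) (φ : Fm) →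
       ⊢ (inputs (contents Λ) ⨟ just (fm (φ °))) →
       ⊢ ((｛ one (φ •) ｝ ∷ []) ⊕ Δ) →
       ⊢ ((｛ Λ ｝ ∷ []) ⊕ Δ))
    ×
    (∀ (Λ : Inputs) {s : Side} (Δ : Content s) (φ : Fm) →
       ⊢ (Λ ⨟ just ｛ one (φ °) ｝) →
       ⊢ ((fm (φ •) ∷ []) ⊕ contents Δ) →
       ⊢ (Λ ⊕ single ｛ Δ ｝))
theorem3p12 =
  (λ Λ Δ φ d e →
    cut-mix φ (All.tabulate λ i → mem (inside (∈-++⁺ˡ i))) d
      (structural e same (mem₀ ∷ inputs-++ (_ ∷ Λ)))) ,
  (λ Λ Δ φ d e →
    -- As for `□°`: the block `Λ` stands in for the block `φ•`.
    simulate e same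
      (elim (elim｛｝ (inside (here refl)) λ cs → cut-mix φ cs d) ∷
       All.map cover-weaken (inputs-++ (_ ∷ [])))) ,
  (λ Λ Δ φ d e → sub° φ Δ d e)
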